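{- Let $G=(V,E)$ be a connected graph, let $\widehat G=(V,E\cup F)$ with $F\subseteq\binom{V}{2}\setminus E$, and let $e\in E\cup F$. If $e\in E$, then the inequality $0\le x_e$ defines a facet of $\mathrm{LMC}(G,\widehat G)$ if and only if no triangle of $\widehat G$ contains $e$. If $e=uv\in F$, then $0\le x_e$ defines a facet of $\mathrm{LMC}(G,\widehat G)$ only if all of the following hold: (i) no triangle of $\widehat G$ contains $e$; (ii) for any two distinct $uv$-cut-nodes $s,t$ with $\{s,t\}\neq\{u,v\}$, the distance between $s$ and $t$ in $\widehat G$ is at least $3$; (iii) there is no triangle in $\widehat G$ with nodes $s,s',t$ such that $\{s,s'\}$ is a $uv$-separating node set and $t$ is a $uv$-cut-node.
   Context: Graphs are finite, simple, undirected; $uv$ denotes $\{u,v\}$. A set $S\subseteq V$ is $uv$-separating (with respect to $G$) if every $uv$-path in $G$ contains at least one node of $S$; a node $w$ is a $uv$-cut-node if $\{w\}$ is $uv$-separating. A decomposition of $G$ is a partition $\Pi$ of $V$ such that each block induces a connected subgraph of $G$; the multicut of $\widehat G$ lifted from $G$ induced by $\Pi$ is the set of edges of $E\cup F$ whose endpoints lie in distinct blocks of $\Pi$. $\mathrm{LMC}(G,\widehat G)\subseteq\mathbb{R}^{E\cup F}$ is the convex hull of the characteristic vectors of all multicuts of $\widehat G$ lifted from $G$.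
   Formalization: LMC(G,Ĝ) is taken as the set of rational points of the convex hull, with rational weights and rational affine independence, instead of a polytope in real space; as the vertices are 0/1 vectors, the dimensions that define a facet are the same. -}

module Defs where

open import Data.Nat using (ℕ; zero; suc)
open import Data.Bool using (Bool; true; false; _∨_)
open import Data.Fin using (Fin; zero; suc; _<_)
open import Data.List using (List; []; _∷_; length)
open import Data.List.Relation.Unary.Any using (Any)
open import Data.List.Relation.Unary.Unique.Propositional using (Unique)
open import Data.Product using (Σ; ∃; _×_; _,_; proj₁; proj₂)
open import Data.Sum using (_⊎_)
open import Relation.Nullary using (¬_)
open import Relation.Binary.PropositionalEquality using (_≡_; _≢_)
open import Data.Rational using (ℚ; 0ℚ; 1ℚ; _+_; _*_; _≤_)
import Data.Nat as N

sumFin : ∀ {m} → (Fin m → ℚ) → ℚ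
sumFin {zero}  f = 0ℚ
sumFin {suc m} f = f zero + sumFin (λ i → f (suc i))

module _ {n : ℕ} (adj : Fin n → Fin n → Bool) where

  data Walk : Fin n → Fin n → Set where
    here : ∀ u → Walk u u
    step : ∀ {u w v} → adj u w ≡ true → Walk w v → Walk u v

  nodes : ∀ {u v} → Walk u v → List (Fin n)
  nodes (here u) = u ∷ []
  nodes (step {u = u} _ p) = u ∷ nodes p

  walkLength : ∀ {u v} → Walk u v → ℕ
  walkLength (here _) = 0
  walkLength (step _ p) = suc (walkLength p)

  IsPath : ∀ {u v} → Walk u v → Set
  IsPath p = Unique (nodes p)

  Connected : Set
  Connected = ∀ u v → Walk u v

module Graph (n : ℕ) (E F : Fin n → Fin n → Bool) where

  V : Set
  V = Fin n

  Ehat : V → V → Bool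
  Ehat i j = E i j ∨ F i j

  -- edges of Ĝ = E ∪ F, each represented once as a pair i < j
  Edge : Set
  Edge = Σ V λ i → Σ V λ j → (i < j) × (Ehat i j ≡ true)

  endˡ endʳ : Edge → V
  endˡ e = proj₁ e
  endʳ e = proj₁ (proj₂ e)

  Point : Set
  Point = Edge → ℚ

  Separating : (V → Set) → V → V → Set
  Separating S u v = (p : Walk E u v) → IsPath E p → Any S (nodes E p)

  CutNode : V → V → V → Set
  CutNode w u v = Separating (λ x → x ≡ w) u v

  DistGe3 : V → V → Set
  DistGe3 s t = ¬ (Σ (Walk Ehat s t) λ p → walkLength Ehat p N.≤ 2)

  Triangle : V → V → V → Set
  Triangle a b c = (a ≢ b) × (b ≢ c) × (a ≢ c)
                 × (Ehat a b ≡ true) × (Ehat b c ≡ true) × (Ehat a c ≡ true)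

  InTriple : V → V → V → V → Set
  InTriple x a b c = (x ≡ a) ⊎ (x ≡ b) ⊎ (x ≡ c)

  TriangleContains : Edge → Set
  TriangleContains e = ∃ λ a → ∃ λ b → ∃ λ c → Triangle a b c
                     × InTriple (endˡ e) a b c × InTriple (endʳ e) a b c

  -- decompositions: a partition of V given by a block label per node
  -- (nodes with equal label form one block); every block must induce a
  -- connected subgraph of G.
  IsDecomposition : (V → V) → Set
  IsDecomposition lab =
    ∀ u v → lab u ≡ lab v →
      Σ (Walk E u v) λ p → Data.List.Relation.Unary.All.All (λ w → lab w ≡ lab u) (nodes E p)
    where import Data.List.Relation.Unary.All

  χ : (Edge → Bool) → Point
  χ M e with M e
  ... | true  = 1ℚ
  ... | false = 0ℚ

  IsLiftedMulticut : (Edge → Bool) → Set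
  IsLiftedMulticut M = Σ (V → V) λ lab → IsDecomposition lab ×
    (∀ e → (M e ≡ true → lab (endˡ e) ≢ lab (endʳ e))
         × (lab (endˡ e) ≢ lab (endʳ e) → M e ≡ true))

  IsLMCVertex : Point → Set
  IsLMCVertex x = Σ (Edge → Bool) λ M → IsLiftedMulticut M × (∀ e → x e ≡ χ M e)

  -- (rational points of) the convex hull of a set of points
  ConvHull : (Point → Set) → Point → Set
  ConvHull X x = Σ ℕ λ m → Σ (Fin m → Point) λ q → Σ (Fin m → ℚ) λ w →
      (∀ i → X (q i)) × (∀ i → 0ℚ ≤ w i) × (sumFin w ≡ 1ℚ)
    × (∀ e → x e ≡ sumFin (λ i → w i * q i e))

  LMC : Point → Set
  LMC = ConvHull IsLMCVertex

  AffInd : ∀ {m} → (Fin m → Point) → Set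
  AffInd {m} p = (λ' : Fin m → ℚ) → sumFin λ' ≡ 0ℚ →
                 (∀ e → sumFin (λ i → λ' i * p i e) ≡ 0ℚ) → ∀ i → λ' i ≡ 0ℚ

  -- S has exactly r affinely independent points at most,
  -- i.e. dim S = r - 1 (r = 0 means S is empty, dimension -1)
  AffRank : (Point → Set) → ℕ → Set
  AffRank S r = (Σ (Fin r → Point) λ p → (∀ i → S (p i)) × AffInd p)
              × ((p : Fin (suc r) → Point) → (∀ i → S (p i)) → ¬ AffInd p)

  Face : Edge → Point → Set
  Face e x = LMC x × (x e ≡ 0ℚ)

  NonnegFacet : Edge → Set
  NonnegFacet e = (∀ x → LMC x → 0ℚ ≤ x e)
                × Σ ℕ λ r → AffRank LMC (suc r) × AffRank (Face e) r

{-# OPTIONS --safe #-}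
module Submission where

-- Both facet criteria compare numbers of affinely independent points.
--
-- Lower bounds: contract the blocks of a decomposition c (trivial for LMC itself, the single
-- block {u, v} for the face x_e = 0 of an edge e = uv of G).  For each edge f of Ĝ take the
-- multicut whose only new block is a shortest path between the ends of f in the contracted
-- graph.  An edge f′ ≠ f with both ends on that path has its ends closer together than f, so
-- these multicuts and the one of c alone form a triangular system.  Absence of triangles
-- through e is what keeps the contracted Ĝ simple.
--
-- Upper bounds: if one of the conditions fails, every vertex with x_e = 0 satisfies a further
-- equation x_g = x_f + x_h with g ∉ {e, f, h}, because the block containing u and v contains
-- every uv-cut-node and meets every uv-separating set.

open import Defs
open import Data.Nat as ℕ using (ℕ; zero; suc; z≤n; s≤s)
import Data.Nat.Properties as ℕ
open import Data.Bool using (Bool; true; false; not; _∨_)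
import Data.Bool.Properties as Bool
open import Data.Fin using (Fin; zero; suc; _<_; punchIn)
import Data.Fin.Properties as Fin
open import Data.Fin.Properties using (any?; all?; ¬∀⟶∃¬; punchInᵢ≢i)
open import Data.Vec.Functional using (insertAt)
open import Data.Vec.Functional.Properties using (insertAt-lookup; insertAt-punchIn)
open import Data.List using (List; []; _∷_; length; lookup; map; concatMap; allFin; filter; deduplicate)
open import Data.List.Membership.Propositional using (_∈_; find; lose)
open import Data.List.Membership.Propositional.Properties using (∈-concatMap⁺; ∈-map⁺; ∈-allFin; ∈-filter⁺; ∈-filter⁻; ∈-deduplicate⁺; ∈-deduplicate⁻; ∈-lookup)
open import Data.List.Relation.Unary.Any as Any using (here; there)
open import Data.List.Relation.Unary.Any.Properties using (lookup-index)
open import Data.List.Relation.Unary.All as All using (All; []; _∷_)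
open import Data.List.Relation.Unary.AllPairs using ([]; _∷_)
open import Data.List.Relation.Unary.Unique.Propositional using (Unique)
import Data.List.Relation.Unary.Unique.DecPropositional.Properties as Unique
open import Data.Product using (Σ; ∃; _×_; _,_; proj₁; proj₂)
open import Data.Sum using (_⊎_; inj₁; inj₂; [_,_]′)
open import Data.Empty using (⊥)
open import Data.Rational using (ℚ; 0ℚ; 1ℚ; _+_; _*_; -_; _-_; _≤_; 1/_; NonZero; ≢-nonZero)
open import Data.Rational.Properties as ℚ using (_≟_)
open import Data.Rational.Solver using (module +-*-Solver)
open import Axiom.UniquenessOfIdentityProofs using (module Decidable⇒UIP)
open import Function using (_∘_; id)
open import Relation.Nullary using (¬_; Dec; yes; no; contradiction; ¬?; ⌊_⌋)
open import Relation.Nullary.Decidable using (map′; _×-dec_; _⊎-dec_)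
open import Relation.Unary using (Decidable)
open import Relation.Binary using (DecidableEquality; tri<; tri≈; tri>)
open import Relation.Binary.PropositionalEquality using (_≡_; _≢_; refl; sym; trans; cong; cong₂; subst; ≢-sym; module ≡-Reasoning)

-- Linear algebra over ℚ

sum-cong : ∀ {m} {f g : Fin m → ℚ} → (∀ i → f i ≡ g i) → sumFin f ≡ sumFin g
sum-cong {zero}  f≗g = refl
sum-cong {suc m} f≗g = cong₂ _+_ (f≗g zero) (sum-cong (f≗g ∘ suc))

sum-zero : ∀ {m} {f : Fin m → ℚ} → (∀ i → f i ≡ 0ℚ) → sumFin f ≡ 0ℚ
sum-zero {zero}  f≗0 = refl
sum-zero {suc m} f≗0 = trans (cong₂ _+_ (f≗0 zero) (sum-zero (f≗0 ∘ suc))) (ℚ.+-identityˡ 0ℚ)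

sum-+ : ∀ {m} (f g : Fin m → ℚ) → sumFin (λ i → f i + g i) ≡ sumFin f + sumFin g
sum-+ {zero}  f g = sym (ℚ.+-identityˡ 0ℚ)
sum-+ {suc m} f g = trans (cong (f zero + g zero +_) (sum-+ (f ∘ suc) (g ∘ suc)))
  (solve 4 (λ a b c d → (a :+ b) :+ (c :+ d) := (a :+ c) :+ (b :+ d)) refl
    (f zero) (g zero) (sumFin (f ∘ suc)) (sumFin (g ∘ suc)))
  where open +-*-Solver

sum-*ˡ : ∀ {m} a (f : Fin m → ℚ) → sumFin (λ i → a * f i) ≡ a * sumFin f
sum-*ˡ {zero}  a f = sym (ℚ.*-zeroʳ a)
sum-*ˡ {suc m} a f = trans (cong (a * f zero +_) (sum-*ˡ a (f ∘ suc)))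
  (sym (ℚ.*-distribˡ-+ a (f zero) (sumFin (f ∘ suc))))

sum-punchIn : ∀ {m} (f : Fin (suc m) → ℚ) i → sumFin f ≡ f i + sumFin (f ∘ punchIn i)
sum-punchIn         f zero    = refl
sum-punchIn {suc m} f (suc i) = trans (cong (f zero +_) (sum-punchIn (f ∘ suc) i))
  (solve 3 (λ a b c → a :+ (b :+ c) := b :+ (a :+ c)) refl
    (f zero) (f (suc i)) (sumFin (f ∘ suc ∘ punchIn i)))
  where open +-*-Solver

sum-single : ∀ {m} (f : Fin m → ℚ) i → (∀ j → j ≢ i → f j ≡ 0ℚ) → sumFin f ≡ f i
sum-single {suc m} f i f≗0 = trans (sum-punchIn f i)
  (trans (cong (f i +_) (sum-zero λ k → f≗0 (punchIn i k) (punchInᵢ≢i i k))) (ℚ.+-identityʳ (f i)))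

sum-nonneg : ∀ {m} {f : Fin m → ℚ} → (∀ i → 0ℚ ≤ f i) → 0ℚ ≤ sumFin f
sum-nonneg {zero}  0≤f = ℚ.≤-refl
sum-nonneg {suc m} 0≤f = ℚ.+-mono-≤ (0≤f zero) (sum-nonneg (0≤f ∘ suc))

sum-nonneg-zero : ∀ {m} (f : Fin m → ℚ) → (∀ i → 0ℚ ≤ f i) → sumFin f ≡ 0ℚ → ∀ i → f i ≡ 0ℚ
sum-nonneg-zero {suc m} f 0≤f Σf≡0 i = ℚ.≤-antisym fi≤0 (0≤f i)
  where
  open ℚ.≤-Reasoning
  fi≤0 : f i ≤ 0ℚ
  fi≤0 = begin
    f i                              ≡⟨ ℚ.+-identityʳ (f i) ⟨
    f i + 0ℚ                         ≤⟨ ℚ.+-monoʳ-≤ (f i) (sum-nonneg (0≤f ∘ punchIn i)) ⟩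
    f i + sumFin (f ∘ punchIn i)     ≡⟨ sum-punchIn f i ⟨
    sumFin f                         ≡⟨ Σf≡0 ⟩
    0ℚ                               ∎

*-≢0 : ∀ {p q} → p ≢ 0ℚ → q ≢ 0ℚ → p * q ≢ 0ℚ
*-≢0 {p} {q} p≢0 q≢0 pq≡0 = q≢0 (begin
  q                ≡⟨ ℚ.*-identityˡ q ⟨
  1ℚ * q           ≡⟨ cong (_* q) (ℚ.*-inverseˡ p) ⟨
  1/ p * p * q     ≡⟨ ℚ.*-assoc (1/ p) p q ⟩
  1/ p * (p * q)   ≡⟨ cong (1/ p *_) pq≡0 ⟩
  1/ p * 0ℚ        ≡⟨ ℚ.*-zeroʳ (1/ p) ⟩
  0ℚ               ∎)
  where
  open ≡-Reasoning
  instance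
    p-nonZero : NonZero p
    p-nonZero = ≢-nonZero p≢0

-- Gaussian elimination, fraction-free: the pivot row is r, the pivot column i.
kernel-vector : ∀ {m k} (rows : Fin m → Fin k → ℚ) → m ℕ.< k →
  Σ (Fin k → ℚ) λ l → (∃ λ i → l i ≢ 0ℚ) × (∀ j → sumFin (λ i → l i * rows j i) ≡ 0ℚ)
kernel-vector {zero}  {suc k} rows _ = (λ _ → 1ℚ) , (zero , λ ()) , λ ()
kernel-vector {suc m} {suc k} rows (s≤s m<k) with all? (λ i → rows zero i ≟ 0ℚ)
... | yes r≗0 =
  let l , l≢0 , l-ker = kernel-vector (rows ∘ suc) (ℕ.m<n⇒m<1+n m<k) in
  l , l≢0 , λ where
    zero    → sum-zero λ i → trans (cong (l i *_) (r≗0 i)) (ℚ.*-zeroʳ (l i))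
    (suc j) → l-ker j
... | no ¬r≗0 = l , (punchIn i k₀ , l≢0) , λ where
    zero    → trans (eliminate r) (sum-zero λ k → trans (cong (l′ k *_) (r-reduced k)) (ℚ.*-zeroʳ (l′ k)))
    (suc j) → trans (eliminate (rows (suc j))) (l′-ker j)
  where
  open ≡-Reasoning
  r : Fin (suc k) → ℚ
  r = rows zero
  pivot = ¬∀⟶∃¬ _ (λ i → r i ≡ 0ℚ) (λ i → r i ≟ 0ℚ) ¬r≗0
  i = proj₁ pivot
  reduce : (Fin (suc k) → ℚ) → Fin k → ℚ
  reduce s k = r i * s (punchIn i k) - r (punchIn i k) * s i
  r-reduced : ∀ k → reduce r k ≡ 0ℚ
  r-reduced k = trans (cong (λ z → r i * r (punchIn i k) - z) (ℚ.*-comm (r (punchIn i k)) (r i)))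
    (ℚ.+-inverseʳ (r i * r (punchIn i k)))
  sub = kernel-vector (reduce ∘ rows ∘ suc) m<k
  l′ = proj₁ sub
  k₀ = proj₁ (proj₁ (proj₂ sub))
  l′-ker = proj₂ (proj₂ sub)
  σ : ℚ
  σ = sumFin (λ k → l′ k * r (punchIn i k))
  l : Fin (suc k) → ℚ
  -- Multiplying the solution of the reduced system by the pivot `r i` avoids division. The entry
  -- `- σ` at the pivot column is then forced: on the row `r` the two contributions are `r i * σ`
  -- and `- σ * r i`.
  l = insertAt (λ k → r i * l′ k) i (- σ)
  l-punchIn : ∀ k → l (punchIn i k) ≡ r i * l′ k
  l-punchIn = insertAt-punchIn (λ k → r i * l′ k) i (- σ)
  l≢0 : l (punchIn i k₀) ≢ 0ℚ
  l≢0 eq = *-≢0 (proj₂ pivot) (proj₂ (proj₁ (proj₂ sub))) (trans (sym (l-punchIn k₀)) eq)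
  rearrange : ∀ s k → l′ k * reduce s k ≡ l (punchIn i k) * s (punchIn i k) + (- s i) * (l′ k * r (punchIn i k))
  rearrange s k = trans
    (solve 5 (λ a b c d e → a :* (b :* c :+ :- (d :* e)) := (b :* a) :* c :+ (:- e) :* (a :* d)) refl
      (l′ k) (r i) (s (punchIn i k)) (r (punchIn i k)) (s i))
    (cong (λ z → z * s (punchIn i k) + (- s i) * (l′ k * r (punchIn i k))) (sym (l-punchIn k)))
    where open +-*-Solver
  -- Stated for an arbitrary row, since it serves twice: the pivot row reduces to zero, and the
  -- reductions of the remaining rows are annihilated by `l′`.
  eliminate : ∀ s → sumFin (λ j → l j * s j) ≡ sumFin (λ k → l′ k * reduce s k)
  eliminate s = begin
    sumFin (λ j → l j * s j)
      ≡⟨ sum-punchIn (λ j → l j * s j) i ⟩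
    l i * s i + rest
      ≡⟨ cong (λ z → z * s i + rest) (insertAt-lookup (λ k → r i * l′ k) i (- σ)) ⟩
    (- σ) * s i + rest
      ≡⟨ solve 3 (λ a b c → (:- a) :* b :+ c := c :+ (:- b) :* a) refl σ (s i) rest ⟩
    rest + (- s i) * σ
      ≡⟨ cong (rest +_) (sum-*ˡ (- s i) (λ k → l′ k * r (punchIn i k))) ⟨
    rest + sumFin (λ k → (- s i) * (l′ k * r (punchIn i k)))
      ≡⟨ sum-+ (λ k → l (punchIn i k) * s (punchIn i k)) (λ k → (- s i) * (l′ k * r (punchIn i k))) ⟨
    sumFin (λ k → l (punchIn i k) * s (punchIn i k) + (- s i) * (l′ k * r (punchIn i k)))
      ≡⟨ sum-cong (rearrange s) ⟨
    sumFin (λ k → l′ k * reduce s k) ∎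
    where
    open +-*-Solver
    rest = sumFin (λ k → l (punchIn i k) * s (punchIn i k))

-- Lists and finite sets

lookup-injective : ∀ {A : Set} {xs : List A} → Unique xs → ∀ i j → lookup xs i ≡ lookup xs j → i ≡ j
lookup-injective (_ ∷ _)   zero    zero    _  = refl
lookup-injective (x∉ ∷ _)  zero    (suc j) eq = contradiction eq (All.lookup x∉ (∈-lookup j))
lookup-injective (x∉ ∷ _)  (suc i) zero    eq = contradiction (sym eq) (All.lookup x∉ (∈-lookup i))
lookup-injective (_ ∷ xs!) (suc i) (suc j) eq = cong suc (lookup-injective xs! i j eq)

-- Used to discard a coordinate that an equation determines; the exact length is what the dimension
-- count needs.
∈-delete : ∀ {A : Set} {x : A} {xs} → x ∈ xs →
  Σ (List A) λ ys → (length xs ≡ suc (length ys)) × (∀ {y} → y ∈ xs → y ≢ x → y ∈ ys)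
∈-delete {xs = _ ∷ xs} (here refl) = xs , refl , λ where
  (here y≡x)   y≢x → contradiction y≡x y≢x
  (there y∈xs) _   → y∈xs
∈-delete {xs = z ∷ xs} (there x∈xs) =
  let ys , len , keep = ∈-delete x∈xs in
  z ∷ ys , cong suc len , λ where
    (here y≡z)   _   → here y≡z
    (there y∈xs) y≢x → there (keep y∈xs y≢x)

Fin-bounded : ∀ {m} (f : Fin m → ℕ) → ∃ λ b → ∀ i → f i ℕ.< b
Fin-bounded {zero}  f = 0 , λ ()
Fin-bounded {suc m} f =
  let b , f<b = Fin-bounded (f ∘ suc) in
  suc (f zero) ℕ.⊔ b , λ where
    zero    → ℕ.m≤m⊔n (suc (f zero)) b
    (suc i) → ℕ.≤-trans (f<b i) (ℕ.m≤n⊔m (suc (f zero)) b)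

least : ∀ {P : ℕ → Set} → Decidable P → ∀ k → P k → ∃ λ d → P d × (∀ j → P j → d ℕ.≤ j)
least P? k Pk with P? 0
least P? k       Pk | yes P0 = 0 , P0 , λ _ _ → z≤n
least P? zero    Pk | no ¬P0 = contradiction Pk ¬P0
least P? (suc k) Pk | no ¬P0 =
  let d , Pd , d≤ = least (P? ∘ suc) k Pk in
  suc d , Pd , λ where
    zero    P0 → contradiction P0 ¬P0
    (suc j) Pj → s≤s (d≤ j Pj)

Listing : Set → Set
Listing A = Σ (List A) λ xs → ∀ x → x ∈ xs

Fin-listing : ∀ {n} → Listing (Fin n)
Fin-listing {n} = allFin n , ∈-allFin

Dec-listing : ∀ {A : Set} → Dec A → (∀ (x y : A) → x ≡ y) → Listing A
Dec-listing (yes a) irr = a ∷ [] , λ x → here (irr x a)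
Dec-listing (no ¬a) irr = [] , λ x → contradiction x ¬a

Σ-listing : ∀ {A : Set} {B : A → Set} → Listing A → (∀ a → Listing (B a)) → Listing (Σ A B)
Σ-listing (xs , ∈xs) ys = concatMap (λ a → map (a ,_) (proj₁ (ys a))) xs , λ where
  (a , b) → ∈-concatMap⁺ (λ a → map (a ,_) (proj₁ (ys a))) (lose (∈xs a) (∈-map⁺ (a ,_) (proj₂ (ys a) b)))

-- Affinely independent points and vertices of LMC

module _ {n : ℕ} (E F : Fin n → Fin n → Bool) where
  open Graph n E F

  AffInd-tail : ∀ {m} {p : Fin (suc m) → Point} → AffInd p → AffInd (p ∘ suc)
  AffInd-tail {p = p} ind l Σl≡0 Σlp≡0 i = ind l₀ (trans (ℚ.+-identityˡ _) Σl≡0)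
    (λ e → trans (cong₂ _+_ (ℚ.*-zeroˡ (p zero e)) (Σlp≡0 e)) (ℚ.+-identityˡ 0ℚ)) (suc i)
    where
    l₀ : Fin _ → ℚ
    l₀ zero    = 0ℚ
    l₀ (suc i) = l i

  AffInd-shrink : ∀ (S : Point → Set) {k m} → k ℕ.≤′ m →
    (Σ (Fin m → Point) λ p → (∀ i → S (p i)) × AffInd p) →
    Σ (Fin k → Point) λ p → (∀ i → S (p i)) × AffInd p
  AffInd-shrink S ℕ.≤′-refl       ps              = ps
  AffInd-shrink S (ℕ.≤′-step k≤m) (p , p∈S , ind) =
    AffInd-shrink S k≤m (p ∘ suc , p∈S ∘ suc , AffInd-tail {p = p} ind)

  -- Restricted to the coordinates f, the differences q₀ - qⱼ form a unitriangular matrix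
  -- in the order given by the rank.
  triangular⇒AffInd : ∀ {m} (q : Fin (suc m) → Point) (f : Fin m → Edge) (rank : Fin m → ℕ) →
    (∀ i → q zero (f i) ≡ 1ℚ) → (∀ i → q (suc i) (f i) ≡ 0ℚ) →
    (∀ i j → j ≢ i → q (suc j) (f i) ≡ 1ℚ ⊎ rank i ℕ.< rank j) → AffInd q
  triangular⇒AffInd {m} q f rank q₀≡1 diag≡0 upper l Σl≡0 Σlq≡0 = λ where
      zero    → trans (sym (sum-single l zero λ where
                  zero    0≢0 → contradiction refl 0≢0
                  (suc j) _   → l-suc≡0 j)) Σl≡0
      (suc i) → l-suc≡0 i
    where
    open ≡-Reasoning
    b = proj₁ (Fin-bounded rank)
    -- As `q zero` is 1 at each `f i`, the factor is the entry of `q zero - q j` at `f i`. The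
    -- affine relation makes every row of these weighted differences sum to zero.
    term : Fin m → Fin (suc m) → ℚ
    term i j = l j * (1ℚ - q j (f i))
    sum-term : ∀ i → sumFin (term i) ≡ 0ℚ
    sum-term i = begin
      sumFin (term i)
        ≡⟨ sum-cong (λ j → solve 2 (λ x y → x :* (con 1ℚ :+ :- y) := x :+ con (- 1ℚ) :* (x :* y)) refl (l j) (q j (f i))) ⟩
      sumFin (λ j → l j + (- 1ℚ) * (l j * q j (f i)))
        ≡⟨ sum-+ l (λ j → (- 1ℚ) * (l j * q j (f i))) ⟩
      sumFin l + sumFin (λ j → (- 1ℚ) * (l j * q j (f i)))
        ≡⟨ cong₂ _+_ Σl≡0 (trans (sum-*ˡ (- 1ℚ) (λ j → l j * q j (f i))) (cong ((- 1ℚ) *_) (Σlq≡0 (f i)))) ⟩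
      0ℚ + (- 1ℚ) * 0ℚ
        ≡⟨⟩
      0ℚ ∎
      where open +-*-Solver
    cut⇒term≡0 : ∀ i j → q j (f i) ≡ 1ℚ → term i j ≡ 0ℚ
    cut⇒term≡0 i j q≡1 = trans (cong (λ z → l j * (1ℚ - z)) q≡1) (ℚ.*-zeroʳ (l j))
    -- Downward induction on the rank, with `k` bounding the gap between `rank i` and `b`. In row
    -- `i` a nonzero off-diagonal entry belongs to a point of larger rank, whose coefficient is
    -- already known to vanish. Gap zero cannot occur, because all ranks lie below `b`.
    descend : ∀ k i → b ℕ.≤ rank i ℕ.+ k → l (suc i) ≡ 0ℚ
    descend zero i b≤ = contradiction
      (subst (b ℕ.≤_) (ℕ.+-identityʳ (rank i)) b≤) (ℕ.<⇒≱ (proj₂ (Fin-bounded rank) i))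
    descend (suc k) i b≤ = begin
      l (suc i)               ≡⟨ ℚ.*-identityʳ (l (suc i)) ⟨
      l (suc i) * (1ℚ - 0ℚ)   ≡⟨ cong (λ z → l (suc i) * (1ℚ - z)) (diag≡0 i) ⟨
      term i (suc i)          ≡⟨ sum-single (term i) (suc i) off-diagonal ⟨
      sumFin (term i)         ≡⟨ sum-term i ⟩
      0ℚ                      ∎
      where
      off-diagonal : ∀ j → j ≢ suc i → term i j ≡ 0ℚ
      off-diagonal zero    _   = cut⇒term≡0 i zero (q₀≡1 i)
      off-diagonal (suc j) j≢i with upper i j (j≢i ∘ cong suc)
      ... | inj₁ q≡1 = cut⇒term≡0 i (suc j) q≡1
      ... | inj₂ i<j = trans (cong (_* (1ℚ - q (suc j) (f i))) (descend k j
              (ℕ.≤-trans b≤ (ℕ.≤-trans (ℕ.≤-reflexive (ℕ.+-suc (rank i) k)) (ℕ.+-monoˡ-≤ k i<j)))))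
              (ℚ.*-zeroˡ (1ℚ - q (suc j) (f i)))
    l-suc≡0 : ∀ i → l (suc i) ≡ 0ℚ
    l-suc≡0 i = descend b i (ℕ.m≤n+m b (rank i))

  -- The coordinates in `L` together with the sum of the coefficients give `suc (length L)`
  -- homogeneous equations in `k` unknowns, so a nonzero solution exists. By `detected` it
  -- annihilates every coordinate and is an affine dependence. The constant row `rows zero` encodes
  -- the coefficient sum.
  detected⇒¬AffInd : ∀ {k} (p : Fin k → Point) (L : List Edge) → suc (length L) ℕ.< k →
    ((l : Fin k → ℚ) → (∀ {f} → f ∈ L → sumFin (λ i → l i * p i f) ≡ 0ℚ) →
      ∀ f → sumFin (λ i → l i * p i f) ≡ 0ℚ) → ¬ AffInd p
  detected⇒¬AffInd {k} p L len detected ind =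
    let l , (i , li≢0) , ker = kernel-vector rows len in
    li≢0 (ind l (trans (sum-cong (λ i → sym (ℚ.*-identityʳ (l i)))) (ker zero))
      (detected l λ f∈L → trans (sum-cong (λ i → cong (λ g → l i * p i g) (lookup-index f∈L)))
        (ker (suc (Any.index f∈L)))) i)
    where
    rows : Fin (suc (length L)) → Fin k → ℚ
    rows zero    i = 1ℚ
    rows (suc j) i = p i (lookup L j)

  -- Multicuts as 0/1 points, and equations on the face.

  IsCutBy : (V → V) → Point → Set
  IsCutBy lab x = ∀ f → (lab (endˡ f) ≡ lab (endʳ f) → x f ≡ 0ℚ) × (lab (endˡ f) ≢ lab (endʳ f) → x f ≡ 1ℚ)

  χ-true : ∀ M f → M f ≡ true → χ M f ≡ 1ℚ
  χ-true M f eq with M f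
  ... | true = refl

  χ-false : ∀ M f → M f ≢ true → χ M f ≡ 0ℚ
  χ-false M f neq with M f
  ... | true  = contradiction refl neq
  ... | false = refl

  vertex⇒cut : ∀ {x} → IsLMCVertex x → Σ (V → V) λ lab → IsDecomposition lab × IsCutBy lab x
  vertex⇒cut (M , (lab , dec , M⇔) , x≡χ) = lab , dec , λ f →
    (λ eq  → trans (x≡χ f) (χ-false M f λ Mf → proj₁ (M⇔ f) Mf eq)) ,
    (λ neq → trans (x≡χ f) (χ-true M f (proj₂ (M⇔ f) neq)))

  cut-vertex : ∀ {lab} → IsDecomposition lab → Σ Point λ x → IsLMCVertex x × IsCutBy lab x
  cut-vertex {lab} dec = χ M , v , proj₂ (proj₂ (vertex⇒cut v))
    where
    M : Edge → Bool
    M f = not ⌊ lab (endˡ f) Fin.≟ lab (endʳ f) ⌋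
    sound : ∀ f → M f ≡ true → lab (endˡ f) ≢ lab (endʳ f)
    sound f Mf with lab (endˡ f) Fin.≟ lab (endʳ f)
    ... | no neq = neq
    complete : ∀ f → lab (endˡ f) ≢ lab (endʳ f) → M f ≡ true
    complete f neq with lab (endˡ f) Fin.≟ lab (endʳ f)
    ... | yes eq = contradiction eq neq
    ... | no _   = refl
    v : IsLMCVertex (χ M)
    v = M , (lab , dec , λ f → sound f , complete f) , λ _ → refl

  vertex⇒LMC : ∀ {x} → IsLMCVertex x → LMC x
  vertex⇒LMC {x} v = 1 , (λ _ → x) , (λ _ → 1ℚ) , (λ _ → v) , (λ _ → ℚ.nonNegative⁻¹ 1ℚ) , refl ,
    λ e → sym (trans (ℚ.+-identityʳ _) (ℚ.*-identityˡ (x e)))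

  cut-cases : ∀ {lab x} → IsCutBy lab x → ∀ f →
    (lab (endˡ f) ≡ lab (endʳ f) × x f ≡ 0ℚ) ⊎ (lab (endˡ f) ≢ lab (endʳ f) × x f ≡ 1ℚ)
  cut-cases {lab} cut f with lab (endˡ f) Fin.≟ lab (endʳ f)
  ... | yes eq = inj₁ (eq , proj₁ (cut f) eq)
  ... | no neq = inj₂ (neq , proj₂ (cut f) neq)

  vertex-value : ∀ {x} → IsLMCVertex x → ∀ f → x f ≡ 0ℚ ⊎ x f ≡ 1ℚ
  vertex-value v f = [ inj₁ ∘ proj₂ , inj₂ ∘ proj₂ ]′ (cut-cases (proj₂ (proj₂ (vertex⇒cut v))) f)

  scaled-vertex-nonneg : ∀ {w x} → 0ℚ ≤ w → IsLMCVertex x → ∀ e → 0ℚ ≤ w * x e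
  scaled-vertex-nonneg {w} 0≤w v e with vertex-value v e
  ... | inj₁ x≡0 = ℚ.≤-reflexive (sym (trans (cong (w *_) x≡0) (ℚ.*-zeroʳ w)))
  ... | inj₂ x≡1 = ℚ.≤-trans 0≤w (ℚ.≤-reflexive (sym (trans (cong (w *_) x≡1) (ℚ.*-identityʳ w))))

  LMC-nonneg : ∀ e x → LMC x → 0ℚ ≤ x e
  LMC-nonneg e x (m , q , w , q-vertex , 0≤w , _ , x≡) =
    subst (0ℚ ≤_) (sym (x≡ e)) (sum-nonneg λ i → scaled-vertex-nonneg (0≤w i) (q-vertex i) e)

  -- A point of the face is a convex combination whose terms at `e` are nonnegative and sum to zero,
  -- hence all vanish. A vertex that is 1 at `e` thus has weight zero and contributes nothing; every
  -- other vertex satisfies the equation by assumption.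
  face-equation : ∀ e f g h → (∀ x → IsLMCVertex x → x e ≡ 0ℚ → x g ≡ x f + x h) →
    ∀ {x} → Face e x → x g ≡ x f + x h
  face-equation e f g h eqn {x} ((m , q , w , q-vertex , 0≤w , _ , x≡) , xe≡0) = begin
    x g                                               ≡⟨ x≡ g ⟩
    sumFin (λ i → w i * q i g)                        ≡⟨ sum-cong termwise ⟩
    sumFin (λ i → w i * q i f + w i * q i h)          ≡⟨ sum-+ (λ i → w i * q i f) (λ i → w i * q i h) ⟩
    sumFin (λ i → w i * q i f) + sumFin (λ i → w i * q i h) ≡⟨ cong₂ _+_ (x≡ f) (x≡ h) ⟨
    x f + x h                                         ∎
    where
    open ≡-Reasoning
    wq≡0 : ∀ i → w i * q i e ≡ 0ℚ
    wq≡0 = sum-nonneg-zero (λ i → w i * q i e) (λ i → scaled-vertex-nonneg (0≤w i) (q-vertex i) e)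
      (trans (sym (x≡ e)) xe≡0)
    termwise : ∀ i → w i * q i g ≡ w i * q i f + w i * q i h
    termwise i with vertex-value (q-vertex i) e
    ... | inj₁ q≡0 = trans (cong (w i *_) (eqn (q i) (q-vertex i) q≡0)) (ℚ.*-distribˡ-+ (w i) (q i f) (q i h))
    ... | inj₂ q≡1 = trans (vanish g) (sym (cong₂ _+_ (vanish f) (vanish h)))
      where
      vanish : ∀ a → w i * q i a ≡ 0ℚ
      vanish a = trans (cong (_* q i a)
        (trans (sym (ℚ.*-identityʳ (w i))) (trans (cong (w i *_) (sym q≡1)) (wq≡0 i)))) (ℚ.*-zeroˡ (q i a))

  -- Enumeration of the edges of Ĝ.

  Bool-≡-irrelevant : {x y : Bool} (p q : x ≡ y) → p ≡ q
  Bool-≡-irrelevant = Decidable⇒UIP.≡-irrelevant Bool._≟_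

  edge-≡ : ∀ {f g : Edge} → endˡ f ≡ endˡ g → endʳ f ≡ endʳ g → f ≡ g
  edge-≡ {i , j , i<j , ij∈} {.i , .j , i<j′ , ij∈′} refl refl =
    cong₂ (λ p q → i , j , p , q) (Fin.<-irrelevant i<j i<j′) (Bool-≡-irrelevant ij∈ ij∈′)

  _≟ᴱ_ : DecidableEquality Edge
  f ≟ᴱ g = map′ (λ (p , q) → edge-≡ p q) (λ eq → cong endˡ eq , cong endʳ eq)
    ((endˡ f Fin.≟ endˡ g) ×-dec (endʳ f Fin.≟ endʳ g))

  Edge-listing : Listing Edge
  Edge-listing = Σ-listing Fin-listing λ i → Σ-listing Fin-listing λ j →
    Dec-listing ((i Fin.<? j) ×-dec (Ehat i j Bool.≟ true))
      λ (p , q) (p′ , q′) → cong₂ _,_ (Fin.<-irrelevant p p′) (Bool-≡-irrelevant q q′)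

  -- These are the coordinates left free once the one at `e` is fixed. Deduplication makes
  -- `suc (length (others e))` the number of edges of Ĝ.
  others : Edge → List Edge
  others e = deduplicate _≟ᴱ_ (filter (λ f → ¬? (f ≟ᴱ e)) (proj₁ Edge-listing))

  others! : ∀ e → Unique (others e)
  others! e = Unique.deduplicate-! _≟ᴱ_ (filter (λ f → ¬? (f ≟ᴱ e)) (proj₁ Edge-listing))

  ≢⇒∈others : ∀ {e f} → f ≢ e → f ∈ others e
  ≢⇒∈others {e} {f} f≢e = ∈-deduplicate⁺ _≟ᴱ_ {xs = filter (λ f → ¬? (f ≟ᴱ e)) (proj₁ Edge-listing)}
    (∈-filter⁺ (λ f → ¬? (f ≟ᴱ e)) (proj₂ Edge-listing f) f≢e)

  ∈others⇒≢ : ∀ {e f} → f ∈ others e → f ≢ e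
  ∈others⇒≢ {e} f∈ = proj₂ (∈-filter⁻ (λ f → ¬? (f ≟ᴱ e)) {xs = proj₁ Edge-listing} (∈-deduplicate⁻ _≟ᴱ_ _ f∈))

  -- Contractions and shortest paths

  module _ (E-sym : ∀ i j → E i j ≡ E j i) where

    -- The conclusion of `IsDecomposition` unfolds to an instance of this type, so connectivity
    -- inside blocks can be composed, reversed and weakened directly.
    WalkIn : (V → Set) → V → V → Set
    WalkIn S x y = Σ (Walk E x y) λ p → All S (nodes E p)

    walkIn-map : ∀ {S T : V → Set} {x y} → (∀ {z} → S z → T z) → WalkIn S x y → WalkIn T x y
    walkIn-map S⊆T (p , p∈S) = p , All.map S⊆T p∈S

    walkIn-trans : ∀ {S : V → Set} {x y z} → WalkIn S x y → WalkIn S y z → WalkIn S x z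
    walkIn-trans (here _ , _)         q = q
    walkIn-trans (step xw p , x∈ ∷ p∈) q =
      let r , r∈ = walkIn-trans (p , p∈) q in step xw r , x∈ ∷ r∈

    walkIn-snoc : ∀ {S : V → Set} {x y z} → WalkIn S x y → E y z ≡ true → S z → WalkIn S x z
    walkIn-snoc {z = z} (here _ , x∈ ∷ [])   yz z∈ = step yz (here z) , x∈ ∷ z∈ ∷ []
    walkIn-snoc (step xw p , x∈ ∷ p∈) yz z∈ =
      let r , r∈ = walkIn-snoc (p , p∈) yz z∈ in step xw r , x∈ ∷ r∈

    walkIn-sym : ∀ {S : V → Set} {x y} → WalkIn S x y → WalkIn S y x
    walkIn-sym (here x , p∈) = here x , p∈
    walkIn-sym (step {u = x} {w = w} xw p , x∈ ∷ p∈) =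
      walkIn-snoc (walkIn-sym (p , p∈)) (trans (E-sym w x) xw) x∈

    suffix : ∀ {x y z} (p : Walk E x y) → z ∈ nodes E p → IsPath E p →
      Σ (Walk E z y) λ q → IsPath E q × (∀ {w} → w ∈ nodes E q → w ∈ nodes E p)
    suffix (here x)    (here refl) p!       = here x , p! , id
    suffix (step xw p) (here refl) p!       = step xw p , p! , id
    suffix (step xw p) (there z∈)  (_ ∷ p!) =
      let q , q! , q⊆p = suffix p z∈ p! in q , q! , there ∘ q⊆p

    -- Blocks supply walks, whereas `Separating` speaks of paths only. If the new first node recurs
    -- on the path already found, the suffix starting there replaces the loop.
    walk⇒path : ∀ {x y} (p : Walk E x y) →
      Σ (Walk E x y) λ q → IsPath E q × (∀ {w} → w ∈ nodes E q → w ∈ nodes E p)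
    walk⇒path (here x) = here x , [] ∷ [] , id
    walk⇒path (step {u = x} xw p) with walk⇒path p
    ... | q , q! , q⊆p with Any.any? (x Fin.≟_) (nodes E q)
    ...   | yes x∈q = let r , r! , r⊆q = suffix q x∈q q! in r , r! , there ∘ q⊆p ∘ r⊆q
    ...   | no  x∉q = step xw q , All.tabulate (λ y∈q x≡y → x∉q (subst (_∈ nodes E q) (sym x≡y) y∈q)) ∷ q! , λ where
              (here eq)   → here eq
              (there w∈q) → there (q⊆p w∈q)

    -- The block joins `u` to `v` by a walk inside itself; a path extracted from that walk uses only
    -- its nodes, and the separator must hit it.
    block-meets-separator : ∀ {S : V → Set} {lab u v} → IsDecomposition lab → lab u ≡ lab v →
      Separating S u v → ∃ λ s → S s × lab s ≡ lab u
    block-meets-separator {u = u} {v} dec eq sep =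
      let p , p∈ = dec u v eq
          q , q! , q⊆p = walk⇒path p
          s , s∈q , Ss = find (sep q q!)
      in s , Ss , All.lookup p∈ (q⊆p s∈q)

    block∋cut-node : ∀ {lab u v s} → IsDecomposition lab → lab u ≡ lab v → CutNode s u v → lab s ≡ lab u
    block∋cut-node dec eq cut with block-meets-separator dec eq cut
    ... | _ , refl , eq′ = eq′

    -- Walks in the contracted graph.

    module Contraction (c : V → V) (c-dec : IsDecomposition c) (E-conn : Connected E) where

      -- walks of length k in the graph obtained from G by contracting the blocks of c
      data CWalk : ℕ → V → V → Set where
        stop : ∀ {x y} → c x ≡ c y → CWalk 0 x y
        step : ∀ {k x x′ w y} → c x ≡ c x′ → E x′ w ≡ true → CWalk k w y → CWalk (suc k) x y

      -- Membership is tested by label, so the nodes on a walk form a union of blocks of `c`.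
      On : ∀ {k x y} → V → CWalk k x y → Set
      On z (stop {x} _)         = c z ≡ c x
      On z (step {x = x} _ _ p) = c z ≡ c x ⊎ On z p

      on? : ∀ {k x y} z (p : CWalk k x y) → Dec (On z p)
      on? z (stop {x} _)         = c z Fin.≟ c x
      on? z (step {x = x} _ _ p) = (c z Fin.≟ c x) ⊎-dec on? z p

      on-resp : ∀ {k x y z z′} (p : CWalk k x y) → c z ≡ c z′ → On z p → On z′ p
      on-resp (stop _)     eq on        = trans (sym eq) on
      on-resp (step _ _ p) eq (inj₁ on) = inj₁ (trans (sym eq) on)
      on-resp (step _ _ p) eq (inj₂ on) = inj₂ (on-resp p eq on)

      on-start : ∀ {k x y} (p : CWalk k x y) → On x p
      on-start (stop _)     = refl
      on-start (step _ _ _) = inj₁ refl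

      on-end : ∀ {k x y} (p : CWalk k x y) → On y p
      on-end (stop eq)    = sym eq
      on-end (step _ _ p) = inj₂ (on-end p)

      -- Each contracted step lifts to G: move inside the current block by `c-dec`, then cross the
      -- edge. This yields connectedness of the merged block.
      walk-on : ∀ {k x y z} (p : CWalk k x y) → On z p → WalkIn (λ w → On w p) x z
      walk-on (stop _)     on        = c-dec _ _ (sym on)
      walk-on (step _ _ p) (inj₁ on) = walkIn-map inj₁ (c-dec _ _ (sym on))
      walk-on {x = x} (step {x′ = x′} eq xw p) (inj₂ on) =
        walkIn-trans (walkIn-snoc (walkIn-map inj₁ (c-dec x x′ eq)) xw (inj₂ (on-start p)))
          (walkIn-map inj₂ (walk-on p on))

      respˡ : ∀ {k x x′ y} → c x ≡ c x′ → CWalk k x y → CWalk k x′ y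
      respˡ eq (stop eq′)      = stop (trans (sym eq) eq′)
      respˡ eq (step eq′ xw p) = step (trans (sym eq) eq′) xw p

      snoc : ∀ {k x y y′ w z} → CWalk k x y → c y ≡ c y′ → E y′ w ≡ true → c w ≡ c z → CWalk (suc k) x z
      snoc (stop eq)      yy′ y′w wz = step (trans eq yy′) y′w (stop wz)
      snoc (step eq xw p) yy′ y′w wz = step eq xw (snoc p yy′ y′w wz)

      reverse : ∀ {k x y} → CWalk k x y → CWalk k y x
      reverse (stop eq) = stop (sym eq)
      reverse (step {x′ = x′} {w} eq xw p) = snoc (reverse p) refl (trans (E-sym w x′) xw) (sym eq)

      prefix : ∀ {k x y z} (p : CWalk k x y) → On z p →
        (∃ λ j → (j ℕ.< k) × CWalk j x z) ⊎ (c z ≡ c y)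
      prefix (stop eq)      on        = inj₂ (trans on eq)
      prefix (step _ _ p)   (inj₁ on) = inj₁ (0 , s≤s z≤n , stop (sym on))
      prefix (step eq xw p) (inj₂ on) with prefix p on
      ... | inj₁ (j , j<k , q) = inj₁ (suc j , s≤s j<k , step eq xw q)
      ... | inj₂ z≡y           = inj₂ z≡y

      -- The stretch of the walk between the blocks of `a` and `b` is strictly shorter than the
      -- whole walk unless these are its two end blocks. Applied to a shortest walk, it makes
      -- distance a triangular order on edges.
      shortcut : ∀ {k x y a b} (p : CWalk k x y) → On a p → On b p → c a ≢ c b →
        (∃ λ j → (j ℕ.< k) × CWalk j a b) ⊎ (c x ≡ c a × c y ≡ c b) ⊎ (c x ≡ c b × c y ≡ c a)
      shortcut (stop _)     a≡x b≡x a≢b = contradiction (trans a≡x (sym b≡x)) a≢b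
      shortcut (step _ _ p) (inj₁ a≡x) (inj₁ b≡x) a≢b = contradiction (trans a≡x (sym b≡x)) a≢b
      shortcut p@(step _ _ _) (inj₁ a≡x) on-b@(inj₂ _) a≢b with prefix p on-b
      ... | inj₁ (j , j<k , q) = inj₁ (j , j<k , respˡ (sym a≡x) q)
      ... | inj₂ b≡y           = inj₂ (inj₁ (sym a≡x , sym b≡y))
      shortcut p@(step _ _ _) on-a@(inj₂ _) (inj₁ b≡x) a≢b with prefix p on-a
      ... | inj₁ (j , j<k , q) = inj₁ (j , j<k , reverse (respˡ (sym b≡x) q))
      ... | inj₂ a≡y           = inj₂ (inj₂ (sym b≡x , sym a≡y))
      shortcut (step _ _ p) (inj₂ on-a) (inj₂ on-b) a≢b with shortcut p on-a on-b a≢b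
      ... | inj₁ (j , j<k , q) = inj₁ (j , ℕ.m<n⇒m<1+n j<k , q)
      -- Here `a` and `b` lie in the end blocks of the tail, so the tail itself, one step shorter
      -- than the walk, joins them.
      ... | inj₂ (inj₁ (w≡a , y≡b)) = inj₁ (_ , ℕ.n<1+n _ , respˡ w≡a (reverse (respˡ y≡b (reverse p))))
      ... | inj₂ (inj₂ (w≡b , y≡a)) = inj₁ (_ , ℕ.n<1+n _ , respˡ y≡a (reverse (respˡ w≡b p)))

      cWalk? : ∀ k x y → Dec (CWalk k x y)
      cWalk? zero    x y = map′ stop (λ { (stop eq) → eq }) (c x Fin.≟ c y)
      cWalk? (suc k) x y = map′ (λ (x′ , w , eq , xw , p) → step eq xw p) (λ { (step eq xw p) → _ , _ , eq , xw , p })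
        (any? λ x′ → any? λ w → (c x Fin.≟ c x′) ×-dec (E x′ w Bool.≟ true) ×-dec cWalk? k w y)

      walk⇒cWalk : ∀ {x y} → Walk E x y → ∃ λ k → CWalk k x y
      walk⇒cWalk (here _)    = 0 , stop refl
      walk⇒cWalk (step xw p) = let k , q = walk⇒cWalk p in suc k , step refl xw q

      -- Connectedness of G provides some walk, and decidability for each fixed length lets `least`
      -- find the distance.
      shortest : ∀ x y → ∃ λ d → CWalk d x y × (∀ j → CWalk j x y → d ℕ.≤ j)
      shortest x y = let k , p = walk⇒cWalk (E-conn x y) in least (λ k → cWalk? k x y) k p

      -- Merging the blocks met by a walk.

      merge : ∀ {k x y} → CWalk k x y → V → V
      merge {x = x} p z with on? z p
      ... | yes _ = c x
      ... | no  _ = c z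

      merge-on : ∀ {k x y z} (p : CWalk k x y) → On z p → merge p z ≡ c x
      merge-on {z = z} p on with on? z p
      ... | yes _  = refl
      ... | no ¬on = contradiction on ¬on

      merge-off : ∀ {k x y z} (p : CWalk k x y) → ¬ On z p → merge p z ≡ c z
      merge-off {z = z} p ¬on with on? z p
      ... | yes on = contradiction on ¬on
      ... | no _   = refl

      merge-cong : ∀ {k x y a b} (p : CWalk k x y) → c a ≡ c b → merge p a ≡ merge p b
      merge-cong {a = a} {b} p eq with on? a p
      ... | yes on = sym (merge-on p (on-resp p eq on))
      ... | no ¬on = trans eq (sym (merge-off p (¬on ∘ on-resp p (sym eq))))

      -- The label `c x` is safe for the merged block: a node carrying it lies in the block of the
      -- start and hence on the walk. This rules out the two mixed cases.
      merge-≡⇒ : ∀ {k x y a b} (p : CWalk k x y) → merge p a ≡ merge p b → (On a p × On b p) ⊎ (c a ≡ c b)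
      merge-≡⇒ {a = a} {b} p eq with on? a p | on? b p
      ... | yes on-a | yes on-b = inj₁ (on-a , on-b)
      ... | yes _    | no ¬on-b = contradiction (on-resp p eq (on-start p)) ¬on-b
      ... | no ¬on-a | yes _    = contradiction (on-resp p (sym eq) (on-start p)) ¬on-a
      ... | no _     | no _     = inj₂ eq

      merge-dec : ∀ {k x y} (p : CWalk k x y) → IsDecomposition (merge p)
      merge-dec p a b eq with merge-≡⇒ p eq
      ... | inj₁ (on-a , on-b) = walkIn-map (λ on → trans (merge-on p on) (sym (merge-on p on-a)))
              (walkIn-trans (walkIn-sym (walk-on p on-a)) (walk-on p on-b))
      ... | inj₂ ca≡cb = walkIn-map (merge-cong p) (c-dec a b ca≡cb)

      -- The triangular system of multicuts.

      module _ (es : List Edge) (es! : Unique es)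
        (es-proper : ∀ {f} → f ∈ es → c (endˡ f) ≢ c (endʳ f))
        (es-simple : ∀ {f g} → f ∈ es → g ∈ es →
          (c (endˡ f) ≡ c (endˡ g) × c (endʳ f) ≡ c (endʳ g)) ⊎ (c (endˡ f) ≡ c (endʳ g) × c (endʳ f) ≡ c (endˡ g)) →
          f ≡ g) where

        path-of : ∀ f → CWalk (proj₁ (shortest (endˡ f) (endʳ f))) (endˡ f) (endʳ f)
        path-of f = proj₁ (proj₂ (shortest (endˡ f) (endʳ f)))

        base = cut-vertex c-dec
        through : ∀ f → Σ Point λ x → IsLMCVertex x × IsCutBy (merge (path-of f)) x
        through f = cut-vertex (merge-dec (path-of f))

        points : Fin (suc (length es)) → Point
        points zero    = proj₁ base
        points (suc i) = proj₁ (through (lookup es i))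

        points-vertex : ∀ i → IsLMCVertex (points i)
        points-vertex zero    = proj₁ (proj₂ base)
        points-vertex (suc i) = proj₁ (proj₂ (through (lookup es i)))

        -- Merging only coarsens `c`, so an edge inside a block of `c` stays uncut throughout. This
        -- places the points on the face when `e` is contracted.
        points-contracted : ∀ {g} → c (endˡ g) ≡ c (endʳ g) → ∀ i → points i g ≡ 0ℚ
        points-contracted {g} eq zero    = proj₁ (proj₂ (proj₂ base) g) eq
        points-contracted {g} eq (suc i) = proj₁ (proj₂ (proj₂ (through (lookup es i))) g) (merge-cong (path-of (lookup es i)) eq)

        points-AffInd : AffInd points
        points-AffInd = triangular⇒AffInd points (lookup es) (rank ∘ lookup es)
          (λ i → proj₂ (proj₂ (proj₂ base) (lookup es i)) (es-proper (∈-lookup i)))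
          (λ i → let f = lookup es i; p = path-of f in
            proj₁ (proj₂ (proj₂ (through f)) f) (trans (merge-on p (on-start p)) (sym (merge-on p (on-end p)))))
          (λ i j j≢i → upper (∈-lookup i) (∈-lookup j) (j≢i ∘ lookup-injective es! j i))
          where
          rank : Edge → ℕ
          rank f = proj₁ (shortest (endˡ f) (endʳ f))
          -- If the multicut through `f` leaves `g` uncut, both ends of `g` lie on the chosen
          -- shortest walk, as `es-proper` excludes a common block of `c`. Then `g` has smaller
          -- distance than `f`, or the two edges have the same end blocks and coincide by
          -- `es-simple`.
          upper : ∀ {g f} → g ∈ es → f ∈ es → f ≢ g → proj₁ (through f) g ≡ 1ℚ ⊎ rank g ℕ.< rank f
          upper {g} {f} g∈ f∈ f≢g with cut-cases (proj₂ (proj₂ (through f))) g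
          ... | inj₂ (_ , x≡1) = inj₁ x≡1
          ... | inj₁ (eq , _) with merge-≡⇒ (path-of f) eq
          ...   | inj₂ ceq = contradiction ceq (es-proper g∈)
          ...   | inj₁ (on-l , on-r) with shortcut (path-of f) on-l on-r (es-proper g∈)
          ...     | inj₁ (j , j<k , q) = inj₂ (ℕ.≤-<-trans (proj₂ (proj₂ (shortest (endˡ g) (endʳ g))) j q) j<k)
          ...     | inj₂ ends = contradiction (es-simple f∈ g∈ ends) f≢g

    -- Facets

    module _ (E-irr : ∀ i → E i i ≡ false)
      (F-sym : ∀ i j → F i j ≡ F j i) (F-irr : ∀ i → F i i ≡ false)
      (E-conn : Connected E) where

      Ehat-sym : ∀ {i j} → Ehat i j ≡ true → Ehat j i ≡ true
      Ehat-sym {i} {j} = trans (cong₂ _∨_ (E-sym j i) (F-sym j i))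

      Ehat⇒≢ : ∀ {i j} → Ehat i j ≡ true → i ≢ j
      Ehat⇒≢ {i} ii∈ refl with trans (sym (cong₂ _∨_ (E-irr i) (F-irr i))) ii∈
      ... | ()

      ends-≢ : ∀ (f : Edge) → endˡ f ≢ endʳ f
      ends-≢ (_ , _ , i<j , _) = Fin.<⇒≢ i<j

      -- An `Edge` stores its smaller end first, so a pair has to be sorted. Hence the two
      -- orientations in the facts that follow.
      edge : ∀ i j → Ehat i j ≡ true → Edge
      edge i j ij∈ with Fin.<-cmp i j
      ... | tri< i<j _ _ = i , j , i<j , ij∈
      ... | tri≈ _ i≡j _ = contradiction i≡j (Ehat⇒≢ ij∈)
      ... | tri> _ _ j<i = j , i , j<i , Ehat-sym ij∈

      edge-ends : ∀ i j ij∈ → let f = edge i j ij∈ in (endˡ f ≡ i × endʳ f ≡ j) ⊎ (endˡ f ≡ j × endʳ f ≡ i)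
      edge-ends i j ij∈ with Fin.<-cmp i j
      ... | tri< _ _ _   = inj₁ (refl , refl)
      ... | tri≈ _ i≡j _ = contradiction i≡j (Ehat⇒≢ ij∈)
      ... | tri> _ _ _   = inj₂ (refl , refl)

      edge-injective : ∀ {i j k l} ij∈ kl∈ → edge i j ij∈ ≡ edge k l kl∈ → (i ≡ k × j ≡ l) ⊎ (i ≡ l × j ≡ k)
      edge-injective {i} {j} {k} {l} ij∈ kl∈ eq = compare (edge-ends i j ij∈) (edge-ends k l kl∈)
        where
        chain : ∀ (end : Edge → V) {a b} → end (edge i j ij∈) ≡ a → end (edge k l kl∈) ≡ b → a ≡ b
        chain end p q = trans (sym p) (trans (cong end eq) q)
        Ends : Edge → V → V → Set
        Ends f a b = (endˡ f ≡ a × endʳ f ≡ b) ⊎ (endˡ f ≡ b × endʳ f ≡ a)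
        compare : Ends (edge i j ij∈) i j → Ends (edge k l kl∈) k l → (i ≡ k × j ≡ l) ⊎ (i ≡ l × j ≡ k)
        compare (inj₁ (i≡ , j≡)) (inj₁ (k≡ , l≡)) = inj₁ (chain endˡ i≡ k≡ , chain endʳ j≡ l≡)
        compare (inj₁ (i≡ , j≡)) (inj₂ (l≡ , k≡)) = inj₂ (chain endˡ i≡ l≡ , chain endʳ j≡ k≡)
        compare (inj₂ (j≡ , i≡)) (inj₁ (k≡ , l≡)) = inj₂ (chain endʳ i≡ l≡ , chain endˡ j≡ k≡)
        compare (inj₂ (j≡ , i≡)) (inj₂ (l≡ , k≡)) = inj₁ (chain endʳ i≡ k≡ , chain endˡ j≡ l≡)

      edge-cut : ∀ {lab x} → IsCutBy lab x → ∀ i j ij∈ →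
        (lab i ≡ lab j → x (edge i j ij∈) ≡ 0ℚ) × (lab i ≢ lab j → x (edge i j ij∈) ≡ 1ℚ)
      edge-cut cut i j ij∈ with Fin.<-cmp i j
      ... | tri< i<j _ _ = cut (i , j , i<j , ij∈)
      ... | tri≈ _ i≡j _ = contradiction i≡j (Ehat⇒≢ ij∈)
      ... | tri> _ _ j<i = (λ eq → proj₁ cutⱼᵢ (sym eq)) , (λ neq → proj₂ cutⱼᵢ (≢-sym neq))
        where cutⱼᵢ = cut (j , i , j<i , Ehat-sym ij∈)

      edge-cut-cong : ∀ {lab x} → IsCutBy lab x → ∀ {i j k l} ij∈ kl∈ →
        (lab i ≡ lab j → lab k ≡ lab l) → (lab k ≡ lab l → lab i ≡ lab j) →
        x (edge i j ij∈) ≡ x (edge k l kl∈)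
      edge-cut-cong {lab} cut {i} {j} {k} {l} ij∈ kl∈ to from with lab i Fin.≟ lab j
      ... | yes eq = trans (proj₁ (edge-cut cut i j ij∈) eq) (sym (proj₁ (edge-cut cut k l kl∈) (to eq)))
      ... | no neq = trans (proj₂ (edge-cut cut i j ij∈) neq) (sym (proj₂ (edge-cut cut k l kl∈) (neq ∘ from)))

      uncut-together : ∀ e {lab x} → IsCutBy lab x → x e ≡ 0ℚ → lab (endˡ e) ≡ lab (endʳ e)
      uncut-together e cut xe≡0 with cut-cases cut e
      ... | inj₁ (eq , _)   = eq
      ... | inj₂ (_ , xe≡1) with trans (sym xe≡0) xe≡1
      ...   | ()

      -- The decomposition into single nodes contracts nothing, so the system covers all edges of Ĝ.
      -- The number of points is one more than the number of edges: LMC is full-dimensional.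
      LMC-points : ∀ e → Σ (Fin (2 ℕ.+ length (others e)) → Point) λ p → (∀ i → LMC (p i)) × AffInd p
      LMC-points e = points es es! proper simple , (λ i → vertex⇒LMC (points-vertex es es! proper simple i)) ,
        points-AffInd es es! proper simple
        where
        id-dec : IsDecomposition id
        id-dec u .u refl = here u , refl ∷ []
        open Contraction id id-dec E-conn
        es = e ∷ others e
        es! : Unique es
        es! = All.tabulate (λ f∈ e≡f → ∈others⇒≢ f∈ (sym e≡f)) ∷ others! e
        proper : ∀ {f} → f ∈ es → endˡ f ≢ endʳ f
        proper {f} _ = ends-≢ f
        simple : ∀ {f g} → f ∈ es → g ∈ es →
          (endˡ f ≡ endˡ g × endʳ f ≡ endʳ g) ⊎ (endˡ f ≡ endʳ g × endʳ f ≡ endˡ g) → f ≡ g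
        simple _ _ (inj₁ (l , r)) = edge-≡ l r
        simple {_ , _ , i<j , _} {_ , _ , j<i , _} _ _ (inj₂ (refl , refl)) = contradiction j<i (Fin.<-asym i<j)

      -- Together with x e = 0, the equation cuts the dimension of the face down by two.
      equation⇒¬facet : ∀ e f g h → g ≢ e → f ≢ g → h ≢ g →
        (∀ x → IsLMCVertex x → x e ≡ 0ℚ → x g ≡ x f + x h) → ¬ NonnegFacet e
      equation⇒¬facet e f g h g≢e f≢g h≢g eqn (_ , r , (_ , LMC-bound) , (p , p∈ , ind) , _) =
        detected⇒¬AffInd p L 1+∣L∣<r detected ind
        where
        open ≡-Reasoning
        del = ∈-delete (≢⇒∈others g≢e)
        L = proj₁ del
        -- The rank `suc r` of LMC forbids `r + 2` independent points, while `LMC-points` gives one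
        -- more than the number of edges; so `r` is at least that number.
        m≤r : suc (length (others e)) ℕ.≤ r
        m≤r = ℕ.≮⇒≥ λ r<m →
          let q , q∈ , q-ind = AffInd-shrink LMC (ℕ.≤⇒≤′ (s≤s r<m)) (LMC-points e) in LMC-bound q q∈ q-ind
        1+∣L∣<r : suc (length L) ℕ.< r
        1+∣L∣<r = subst (ℕ._< r) (proj₁ (proj₂ del)) m≤r
        Vanishes : (Fin r → ℚ) → Edge → Set
        Vanishes l a = sumFin (λ i → l i * p i a) ≡ 0ℚ
        away : ∀ l → (∀ {a} → a ∈ L → Vanishes l a) → ∀ a → a ≢ g → Vanishes l a
        away l L≡0 a a≢g with a ≟ᴱ e
        ... | yes refl = sum-zero λ i → trans (cong (l i *_) (proj₂ (p∈ i))) (ℚ.*-zeroʳ (l i))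
        ... | no a≢e   = L≡0 (proj₂ (proj₂ del) (≢⇒∈others a≢e) a≢g)
        detected : ∀ l → (∀ {a} → a ∈ L → Vanishes l a) → ∀ a → Vanishes l a
        detected l L≡0 a with a ≟ᴱ g
        ... | no a≢g   = away l L≡0 a a≢g
        ... | yes refl = begin
          sumFin (λ i → l i * p i g)
            ≡⟨ sum-cong (λ i → trans (cong (l i *_) (face-equation e f g h eqn (p∈ i))) (ℚ.*-distribˡ-+ (l i) (p i f) (p i h))) ⟩
          sumFin (λ i → l i * p i f + l i * p i h)
            ≡⟨ sum-+ (λ i → l i * p i f) (λ i → l i * p i h) ⟩
          sumFin (λ i → l i * p i f) + sumFin (λ i → l i * p i h)
            ≡⟨ cong₂ _+_ (away l L≡0 f f≢g) (away l L≡0 h h≢g) ⟩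
          0ℚ + 0ℚ
            ≡⟨⟩
          0ℚ ∎

      -- The coordinate at `e`, zero on the face, pads the equality to three terms. Since the
      -- left-hand coordinate must differ from `e`, the sides are exchanged when `a` is `e`, and
      -- `x a` is used twice.
      equal-coordinates⇒¬facet : ∀ e a b → a ≢ b →
        (∀ x → IsLMCVertex x → x e ≡ 0ℚ → x a ≡ x b) → ¬ NonnegFacet e
      equal-coordinates⇒¬facet e a b a≢b eqn with a ≟ᴱ e
      ... | yes refl = equation⇒¬facet a a b a (≢-sym a≢b) a≢b a≢b
              λ x v xa≡0 → trans (sym (eqn x v xa≡0)) (sym (trans (cong (x a +_) xa≡0) (ℚ.+-identityʳ (x a))))
      ... | no a≢e = equation⇒¬facet e b a e a≢e (≢-sym a≢b) (≢-sym a≢e)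
              λ x v xe≡0 → trans (eqn x v xe≡0) (sym (trans (cong (x b +_) xe≡0) (ℚ.+-identityʳ (x b))))

      -- Necessary conditions for a facet.

      Together : Edge → V → V → Set
      Together e s t = ∀ {lab} → IsDecomposition lab → lab (endˡ e) ≡ lab (endʳ e) → lab s ≡ lab t

      -- An edge `st` would be uncut on the whole face, a second coordinate fixed at zero. The two
      -- excluded orientations ensure that this edge is not `e`.
      together⇒¬adjacent : ∀ e → NonnegFacet e → ∀ {s t} → Together e s t →
        ¬ (s ≡ endˡ e × t ≡ endʳ e) → ¬ (s ≡ endʳ e × t ≡ endˡ e) → Ehat s t ≢ true
      together⇒¬adjacent e facet {s} {t} together ¬st ¬ts st∈ =
        equal-coordinates⇒¬facet e st e st≢e eqn facet
        where
        st = edge s t st∈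
        st≢e : st ≢ e
        st≢e eq with edge-ends s t st∈
        ... | inj₁ (l , r) = ¬st (trans (sym l) (cong endˡ eq) , trans (sym r) (cong endʳ eq))
        ... | inj₂ (l , r) = ¬ts (trans (sym r) (cong endʳ eq) , trans (sym l) (cong endˡ eq))
        eqn : ∀ x → IsLMCVertex x → x e ≡ 0ℚ → x st ≡ x e
        eqn x v xe≡0 =
          let lab , dec , cut = vertex⇒cut v in
          trans (proj₁ (edge-cut cut s t st∈) (together dec (uncut-together e cut xe≡0))) (sym xe≡0)

      -- With `s` and `t` in one block, `w` is separated from both or from neither, so the edges
      -- `sw` and `wt` have equal coordinates on the face.
      together⇒¬common-neighbour : ∀ e → NonnegFacet e → ∀ {s w t} → Together e s t → s ≢ t →
        Ehat s w ≡ true → Ehat w t ≢ true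
      together⇒¬common-neighbour e facet {s} {w} {t} together s≢t sw∈ wt∈ =
        equal-coordinates⇒¬facet e (edge s w sw∈) (edge w t wt∈) sw≢wt eqn facet
        where
        sw≢wt : edge s w sw∈ ≢ edge w t wt∈
        sw≢wt eq with edge-injective sw∈ wt∈ eq
        ... | inj₁ (s≡w , _) = Ehat⇒≢ sw∈ s≡w
        ... | inj₂ (s≡t , _) = s≢t s≡t
        eqn : ∀ x → IsLMCVertex x → x e ≡ 0ℚ → x (edge s w sw∈) ≡ x (edge w t wt∈)
        eqn x v xe≡0 =
          let lab , dec , cut = vertex⇒cut v
              s~t = together dec (uncut-together e cut xe≡0)
          in edge-cut-cong cut sw∈ wt∈ (λ s~w → trans (sym s~w) s~t) (λ w~t → trans s~t (sym w~t))

      triangle⇒common-neighbour : ∀ e → TriangleContains e →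
        ∃ λ w → Ehat (endˡ e) w ≡ true × Ehat w (endʳ e) ≡ true
      triangle⇒common-neighbour e@(_ , _ , _ , _) (a , b , c , (_ , _ , _ , ab , bc , ac) , u∈ , v∈) with u∈ | v∈
      ... | inj₁ refl        | inj₂ (inj₁ refl) = c , ac , Ehat-sym bc
      ... | inj₁ refl        | inj₂ (inj₂ refl) = b , ab , bc
      ... | inj₂ (inj₁ refl) | inj₁ refl        = c , bc , Ehat-sym ac
      ... | inj₂ (inj₁ refl) | inj₂ (inj₂ refl) = a , Ehat-sym ab , ac
      ... | inj₂ (inj₂ refl) | inj₁ refl        = b , Ehat-sym bc , Ehat-sym ab
      ... | inj₂ (inj₂ refl) | inj₂ (inj₁ refl) = a , Ehat-sym ac , ab
      ... | inj₁ refl        | inj₁ u≡v         = contradiction (sym u≡v) (ends-≢ e)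
      ... | inj₂ (inj₁ refl) | inj₂ (inj₁ u≡v)  = contradiction (sym u≡v) (ends-≢ e)
      ... | inj₂ (inj₂ refl) | inj₂ (inj₂ u≡v)  = contradiction (sym u≡v) (ends-≢ e)

      facet⇒¬triangle : ∀ e → NonnegFacet e → ¬ TriangleContains e
      facet⇒¬triangle e facet tri =
        let _ , uw∈ , wv∈ = triangle⇒common-neighbour e tri in
        -- The ends of `e` are trivially together, and the third node of the triangle is their
        -- common neighbour.
        together⇒¬common-neighbour e facet (λ _ u~v → u~v) (ends-≢ e) uw∈ wv∈

      cut-nodes-together : ∀ e {s t} → CutNode s (endˡ e) (endʳ e) → CutNode t (endˡ e) (endʳ e) → Together e s t
      cut-nodes-together e s-cut t-cut dec u~v =
        trans (block∋cut-node dec u~v s-cut) (sym (block∋cut-node dec u~v t-cut))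

      facet⇒cut-nodes-distant : ∀ e → NonnegFacet e → ∀ s t → s ≢ t →
        CutNode s (endˡ e) (endʳ e) → CutNode t (endˡ e) (endʳ e) →
        ¬ (s ≡ endˡ e × t ≡ endʳ e) → ¬ (s ≡ endʳ e × t ≡ endˡ e) → DistGe3 s t
      facet⇒cut-nodes-distant e facet s t s≢t s-cut t-cut ¬st ¬ts (p , ∣p∣≤2) = ¬short p ∣p∣≤2
        where
        together : Together e s t
        together = cut-nodes-together e s-cut t-cut
        ¬short : ∀ (p : Walk Ehat s t) → ¬ walkLength Ehat p ℕ.≤ 2
        ¬short (here _)                     _              = s≢t refl
        ¬short (step st∈ (here _))            _              = together⇒¬adjacent e facet together ¬st ¬ts st∈
        ¬short (step sw∈ (step wt∈ (here _))) _              = together⇒¬common-neighbour e facet together s≢t sw∈ wt∈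
        ¬short (step _ (step _ (step _ _)))   (s≤s (s≤s ()))

      -- On the face, t lies in the block of e together with s or s′, so x(ss′) = x(st) + x(s′t).
      facet⇒¬separating-triangle : ∀ e → NonnegFacet e → ∀ s s′ t → Triangle s s′ t →
        Separating (λ x → (x ≡ s) ⊎ (x ≡ s′)) (endˡ e) (endʳ e) → ¬ CutNode t (endˡ e) (endʳ e)
      facet⇒¬separating-triangle e facet s s′ t tri@(s≢s′ , s′≢t , s≢t , ss′∈ , s′t∈ , st∈) sep t-cut =
        equation⇒¬facet e (edge s t st∈) (edge s s′ ss′∈) (edge s′ t s′t∈) ss′≢e st≢ss′ s′t≢ss′ eqn facet
        where
        -- The left-hand coordinate must differ from `e`; otherwise the triangle would contain `e`,
        -- which is already excluded.
        ss′≢e : edge s s′ ss′∈ ≢ e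
        ss′≢e eq with edge-ends s s′ ss′∈
        ... | inj₁ (l , r) = facet⇒¬triangle e facet (s , s′ , t , tri ,
                inj₁ (trans (cong endˡ (sym eq)) l) , inj₂ (inj₁ (trans (cong endʳ (sym eq)) r)))
        ... | inj₂ (l , r) = facet⇒¬triangle e facet (s , s′ , t , tri ,
                inj₂ (inj₁ (trans (cong endˡ (sym eq)) l)) , inj₁ (trans (cong endʳ (sym eq)) r))
        st≢ss′ : edge s t st∈ ≢ edge s s′ ss′∈
        st≢ss′ eq with edge-injective st∈ ss′∈ eq
        ... | inj₁ (_ , t≡s′) = s′≢t (sym t≡s′)
        ... | inj₂ (s≡s′ , _) = s≢s′ s≡s′
        s′t≢ss′ : edge s′ t s′t∈ ≢ edge s s′ ss′∈
        s′t≢ss′ eq with edge-injective s′t∈ ss′∈ eq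
        ... | inj₁ (s′≡s , _) = s≢s′ (sym s′≡s)
        ... | inj₂ (_ , t≡s)  = s≢t (sym t≡s)
        eqn : ∀ x → IsLMCVertex x → x e ≡ 0ℚ → x (edge s s′ ss′∈) ≡ x (edge s t st∈) + x (edge s′ t s′t∈)
        eqn x v xe≡0 with vertex⇒cut v
        ... | lab , dec , cut with block∋cut-node dec (uncut-together e cut xe≡0) t-cut
                                 | block-meets-separator dec (uncut-together e cut xe≡0) sep
        ... | t~u | _ , inj₁ refl , s~u = trans
                (edge-cut-cong cut ss′∈ s′t∈ (λ s~s′ → trans (sym s~s′) s~t) (λ s′~t → trans s~t (sym s′~t)))
                (sym (trans (cong (_+ x (edge s′ t s′t∈)) (proj₁ (edge-cut cut s t st∈) s~t)) (ℚ.+-identityˡ _)))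
          where
          s~t : lab s ≡ lab t
          s~t = trans s~u (sym t~u)
        ... | t~u | _ , inj₂ refl , s′~u = trans
                (edge-cut-cong cut ss′∈ st∈ (λ s~s′ → trans s~s′ s′~t) (λ s~t → trans s~t (sym s′~t)))
                (sym (trans (cong (x (edge s t st∈) +_) (proj₁ (edge-cut cut s′ t s′t∈) s′~t)) (ℚ.+-identityʳ _)))
          where
          s′~t : lab s′ ≡ lab t
          s′~t = trans s′~u (sym t~u)

      -- Sufficiency for an edge of G in no triangle.

      module _ (u v : V) (u<v : u < v) (uv∈ : Ehat u v ≡ true) (uv∈E : E u v ≡ true)
        (¬tri : ¬ TriangleContains (u , v , u<v , uv∈)) where

        e : Edge
        e = u , v , u<v , uv∈

        no-common-neighbour : ∀ {w} → Ehat w u ≡ true → Ehat w v ≢ true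
        no-common-neighbour {w} wu wv = ¬tri (w , u , v ,
          (Ehat⇒≢ wu , Fin.<⇒≢ u<v , Ehat⇒≢ wv , wu , uv∈ , wv) , inj₂ (inj₁ refl) , inj₂ (inj₂ refl))

        contract : V → V
        contract z with z Fin.≟ v
        ... | yes _ = u
        ... | no  _ = z

        contract-v : contract v ≡ u
        contract-v with v Fin.≟ v
        ... | yes _  = refl
        ... | no v≢v = contradiction refl v≢v

        contract-u : contract u ≡ u
        contract-u with u Fin.≟ v
        ... | yes _ = refl
        ... | no _  = refl

        contract-≡ : ∀ x y → contract x ≡ contract y → x ≡ y ⊎ (x ≡ u × y ≡ v) ⊎ (x ≡ v × y ≡ u)
        contract-≡ x y eq with x Fin.≟ v | y Fin.≟ v
        ... | yes refl | yes refl = inj₁ refl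
        ... | yes x≡v  | no _     = inj₂ (inj₂ (x≡v , sym eq))
        ... | no _     | yes y≡v  = inj₂ (inj₁ (eq , y≡v))
        ... | no _     | no _     = inj₁ eq

        -- Membership of `uv` in `E` enters here: it makes the block of `u` and `v` connected in G.
        contract-dec : IsDecomposition contract
        contract-dec x y eq with contract-≡ x y eq
        ... | inj₁ refl                 = here x , refl ∷ []
        ... | inj₂ (inj₁ (refl , refl)) = step uv∈E (here v) , refl ∷ sym eq ∷ []
        ... | inj₂ (inj₂ (refl , refl)) = step (trans (E-sym v u) uv∈E) (here u) , refl ∷ sym eq ∷ []

        -- If exactly one end differs, the two edges share the other end and reach `u` and `v`
        -- respectively, which gives a common neighbour and so a triangle. If both ends differ, each
        -- edge would join `u` or `v` to `u` or `v` and be contracted.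
        contract-injective : ∀ {a b x y} → Ehat a b ≡ true → Ehat x y ≡ true → contract a ≢ contract b →
          contract a ≡ contract x → contract b ≡ contract y → a ≡ x × b ≡ y
        contract-injective {a} {b} {x} {y} ab xy a≁b a~x b~y with contract-≡ a x a~x | contract-≡ b y b~y
        ... | inj₁ refl | inj₁ refl                 = refl , refl
        ... | inj₁ refl | inj₂ (inj₁ (refl , refl)) = contradiction xy (no-common-neighbour ab)
        ... | inj₁ refl | inj₂ (inj₂ (refl , refl)) = contradiction ab (no-common-neighbour xy)
        ... | inj₂ (inj₁ (refl , refl)) | inj₁ refl = contradiction (Ehat-sym xy) (no-common-neighbour (Ehat-sym ab))
        ... | inj₂ (inj₂ (refl , refl)) | inj₁ refl = contradiction (Ehat-sym ab) (no-common-neighbour (Ehat-sym xy))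
        ... | inj₂ (inj₁ (refl , refl)) | inj₂ (inj₁ (refl , refl)) = contradiction refl a≁b
        ... | inj₂ (inj₁ (refl , refl)) | inj₂ (inj₂ (refl , refl)) = contradiction a~x a≁b
        ... | inj₂ (inj₂ (refl , refl)) | inj₂ (inj₁ (refl , refl)) = contradiction a~x a≁b
        ... | inj₂ (inj₂ (refl , refl)) | inj₂ (inj₂ (refl , refl)) = contradiction refl a≁b

        others-proper : ∀ {f} → f ∈ others e → contract (endˡ f) ≢ contract (endʳ f)
        others-proper {f@(i , j , i<j , _)} f∈ eq with contract-≡ i j eq
        ... | inj₁ i≡j                  = ends-≢ f i≡j
        ... | inj₂ (inj₁ (i≡u , j≡v))   = ∈others⇒≢ f∈ (edge-≡ i≡u j≡v)
        ... | inj₂ (inj₂ (refl , refl)) = Fin.<-asym u<v i<j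

        others-simple : ∀ {f g} → f ∈ others e → g ∈ others e →
          (contract (endˡ f) ≡ contract (endˡ g) × contract (endʳ f) ≡ contract (endʳ g))
            ⊎ (contract (endˡ f) ≡ contract (endʳ g) × contract (endʳ f) ≡ contract (endˡ g)) → f ≡ g
        others-simple {_ , _ , _ , f∈Ê} {_ , _ , _ , g∈Ê} f∈ g∈ (inj₁ (l , r)) =
          let l≡ , r≡ = contract-injective f∈Ê g∈Ê (others-proper f∈) l r in edge-≡ l≡ r≡
        others-simple {_ , _ , i<j , f∈Ê} {_ , _ , j<i , g∈Ê} f∈ g∈ (inj₂ (l , r))
          with contract-injective f∈Ê (Ehat-sym g∈Ê) (others-proper f∈) l r
        ... | refl , refl = contradiction j<i (Fin.<-asym i<j)

        face-points : Σ (Fin (suc (length (others e))) → Point) λ p → (∀ i → Face e (p i)) × AffInd p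
        face-points = points es es! others-proper others-simple ,
          (λ i → vertex⇒LMC (points-vertex es es! others-proper others-simple i) ,
                 points-contracted es es! others-proper others-simple {e} (trans contract-u (sym contract-v)) i) ,
          points-AffInd es es! others-proper others-simple
          where
          open Contraction contract contract-dec E-conn
          es = others e
          es! = others! e

        ¬triangle⇒facet : NonnegFacet e
        -- The witness `r` is the number of edges of Ĝ. All coordinates bound LMC by `r + 1`
        -- independent points; on the face the coordinate at `e` vanishes, so `others e` suffices
        -- and the bound is `r`.
        ¬triangle⇒facet = LMC-nonneg e , suc (length (others e)) ,
          (LMC-points e , λ p _ → detected⇒¬AffInd p (e ∷ others e) ℕ.≤-refl
            λ l es≡0 f → es≡0 (∈e∷others f)) ,
          (face-points , λ p p∈ → detected⇒¬AffInd p (others e) ℕ.≤-refl (face-detected p p∈))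
          where
          ∈e∷others : ∀ f → f ∈ e ∷ others e
          ∈e∷others f with f ≟ᴱ e
          ... | yes f≡e = here f≡e
          ... | no f≢e  = there (≢⇒∈others f≢e)
          face-detected : ∀ {k} (p : Fin k → Point) → (∀ i → Face e (p i)) → (l : Fin k → ℚ) →
            (∀ {f} → f ∈ others e → sumFin (λ i → l i * p i f) ≡ 0ℚ) → ∀ f → sumFin (λ i → l i * p i f) ≡ 0ℚ
          face-detected p p∈ l es≡0 f with ∈e∷others f
          ... | here refl = sum-zero λ i → trans (cong (l i *_) (proj₂ (p∈ i))) (ℚ.*-zeroʳ (l i))
          ... | there f∈  = es≡0 f∈

theorem5p7 : (n : ℕ) (E F : Fin n → Fin n → Bool)
    → (∀ i j → E i j ≡ E j i) → (∀ i → E i i ≡ false)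
    → (∀ i j → F i j ≡ F j i) → (∀ i → F i i ≡ false)
    → (∀ i j → E i j ≡ true → F i j ≡ false)
    → Connected E
    → let open Graph n E F in
    ((e : Edge) → E (endˡ e) (endʳ e) ≡ true
    → (NonnegFacet e → ¬ TriangleContains e) × (¬ TriangleContains e → NonnegFacet e))
    × ((e : Edge) → F (endˡ e) (endʳ e) ≡ true → NonnegFacet e
    → (¬ TriangleContains e)
    × (∀ s t → s ≢ t → CutNode s (endˡ e) (endʳ e) → CutNode t (endˡ e) (endʳ e)
    → ¬ (s ≡ endˡ e × t ≡ endʳ e) → ¬ (s ≡ endʳ e × t ≡ endˡ e)
    → DistGe3 s t)
    × (∀ s s' t → Triangle s s' t
    → Separating (λ x → (x ≡ s) ⊎ (x ≡ s')) (endˡ e) (endʳ e)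
    → CutNode t (endˡ e) (endʳ e) → ⊥))
theorem5p7 n E F E-sym E-irr F-sym F-irr _ E-conn =
  (λ e uv∈E → facet⇒¬triangle E F E-sym E-irr F-sym F-irr E-conn e ,
    ¬triangle⇒facet E F E-sym E-irr F-sym F-irr E-conn _ _ _ _ uv∈E) ,
  (λ e _ facet → facet⇒¬triangle E F E-sym E-irr F-sym F-irr E-conn e facet ,
    facet⇒cut-nodes-distant E F E-sym E-irr F-sym F-irr E-conn e facet ,
    facet⇒¬separating-triangle E F E-sym E-irr F-sym F-irr E-conn e facet)
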